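{- Let $m\ge 1$ and $s\ge 2$ be integers. If $G_v(s)$ is the graph obtained from $mC_6$ by attaching $s$ pendant edges to a single vertex of $mC_6$, then $\chi_{lt}(G_v(s))=\Delta(G_v(s))+1=s+3$.
   Context: $mC_6$ is the disjoint union of $m$ copies of the cycle $C_6$ on 6 vertices. Attaching $s$ pendant edges to a vertex $v$ means adding $s$ new vertices, each joined only to $v$. $\Delta(G)$ is the maximum degree. For a finite simple graph $G=(V,E)$ of order $p$ and size $q$, a local total antimagic labeling is a bijection $f:V\cup E\to\{1,\dots,p+q\}$ such that, with weights $w_f(u)=\sum f(e)$ over all edges $e$ incident to $u$ for $u\in V$ (the label of $u$ itself is not included) and $w_f(uv)=f(u)+f(v)$ for $uv\in E$, one has: adjacent vertices have distinct weights, adjacent edges have distinct weights, and every vertex has a weight distinct from that of each of its incident edges. $\chi_{lt}(G)$ is the minimum, over all local total antimagic labelings $f$ of $G$, of the number of distinct values among all the vertex and edge weights. -}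

module Defs where

open import Data.Fin.Base using (Fin; toℕ)
open import Data.Fin.Properties using (+↔⊎; *↔×; all?; inj⇒≟; _≟_)
open import Data.List.Base using (List; map; filter; length; allFin; deduplicate; _++_)
open import Data.List.Extrema.Nat using (max)
open import Data.Nat.Base using (ℕ; suc; _+_; _*_; _≤_)
open import Data.Nat.DivMod using (_mod_)
open import Data.Nat.ListAction using (sum)
import Data.Nat.Properties as ℕ
open import Data.Product.Base using (_×_; _,_; proj₁; proj₂; ∃-syntax)
open import Data.Product.Function.NonDependent.Propositional using (_×-↔_)
open import Data.Sum.Base using (_⊎_; inj₁; inj₂)
open import Data.Sum.Function.Propositional using (_⊎-↔_)
open import Data.Sum.Properties using (inj₁-injective; inj₂-injective)
open import Function.Base using (_∘_)
open import Function.Bundles using (_↔_; _⤖_; Inverse; Bijection)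
open import Function.Construct.Composition using (_↔-∘_)
open import Function.Construct.Identity using (↔-id)
open import Function.Construct.Symmetry using (↔-sym)
open import Function.Properties.Inverse using (↔⇒↣)
open import Relation.Binary.Definitions using (DecidableEquality)
open import Relation.Binary.PropositionalEquality.Core using (_≡_; _≢_; cong; cong₂)
open import Relation.Nullary.Decidable using (Dec; _⊎-dec_; _×-dec_; _→-dec_; ¬?; toWitness)

SamePair : {A : Set} → A × A → A × A → Set
SamePair (a , b) (c , d) = (a ≡ c × b ≡ d) ⊎ (a ≡ d × b ≡ c)

-- An edge is given by an arbitrarily ordered pair of ends.  By `loopless` and
-- `simple`, edges correspond exactly to certain two-element sets of vertices.
record Graph : Set₁ where
  field
    Vertex   : Set
    Edge     : Set
    order    : ℕ
    size     : ℕ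
    vertex↔  : Vertex ↔ Fin order
    edge↔    : Edge ↔ Fin size
    ends     : Edge → Vertex × Vertex
    loopless : ∀ e → proj₁ (ends e) ≢ proj₂ (ends e)
    simple   : ∀ e e′ → SamePair (ends e) (ends e′) → e ≡ e′

  infix 4 _≟ᵛ_ _∈ₑ_ _∈ₑ?_

  _≟ᵛ_ : DecidableEquality Vertex
  _≟ᵛ_ = inj⇒≟ (↔⇒↣ vertex↔)

  vertices : List Vertex
  vertices = map (Inverse.from vertex↔) (allFin order)

  edges : List Edge
  edges = map (Inverse.from edge↔) (allFin size)

  _∈ₑ_ : Vertex → Edge → Set
  x ∈ₑ e = x ≡ proj₁ (ends e) ⊎ x ≡ proj₂ (ends e)

  _∈ₑ?_ : ∀ x e → Dec (x ∈ₑ e)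
  x ∈ₑ? e = (x ≟ᵛ proj₁ (ends e)) ⊎-dec (x ≟ᵛ proj₂ (ends e))

  incidentEdges : Vertex → List Edge
  incidentEdges x = filter (x ∈ₑ?_) edges

  degree : Vertex → ℕ
  degree x = length (incidentEdges x)

  AdjacentVertices : Vertex → Vertex → Set
  AdjacentVertices x y = ∃[ e ] SamePair (ends e) (x , y)

  AdjacentEdges : Edge → Edge → Set
  AdjacentEdges e e′ = e ≢ e′ × ∃[ x ] (x ∈ₑ e × x ∈ₑ e′)

open Graph

Δ : Graph → ℕ
Δ G = max 0 (map (degree G) (vertices G))

Labeling : Graph → Set
Labeling G = (Vertex G ⊎ Edge G) ⤖ Fin (order G + size G)

module _ (G : Graph) (f : Labeling G) where

  -- `Fin n` is {0,…,n−1}, whereas labels range over {1,…,n}.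
  label : Vertex G ⊎ Edge G → ℕ
  label z = suc (toℕ (Bijection.to f z))

  vertexWeight : Vertex G → ℕ
  vertexWeight u = sum (map (label ∘ inj₂) (incidentEdges G u))

  edgeWeight : Edge G → ℕ
  edgeWeight e = label (inj₁ (proj₁ (ends G e))) + label (inj₁ (proj₂ (ends G e)))

  record IsLocalTotalAntimagic : Set where
    field
      vertices-distinct  : ∀ x y → AdjacentVertices G x y → vertexWeight x ≢ vertexWeight y
      edges-distinct     : ∀ e e′ → AdjacentEdges G e e′ → edgeWeight e ≢ edgeWeight e′
      incidence-distinct : ∀ x e → _∈ₑ_ G x e → vertexWeight x ≢ edgeWeight e

  numberOfWeights : ℕ
  numberOfWeights =
    length (deduplicate ℕ._≟_ (map vertexWeight (vertices G) ++ map edgeWeight (edges G)))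

-- A relation rather than a function: the minimum is not known in advance to
-- exist, since a graph may have no local total antimagic labeling.
infix 4 χlt[_]≡_

χlt[_]≡_ : Graph → ℕ → Set
χlt[ G ]≡ k =
  (∃[ f ] (IsLocalTotalAntimagic G f × numberOfWeights G f ≡ k)) ×
  (∀ f → IsLocalTotalAntimagic G f → k ≤ numberOfWeights G f)

next : Fin 6 → Fin 6
next i = suc (toℕ i) mod 6

C₆ : Graph
C₆ = record
  { Vertex   = Fin 6
  ; Edge     = Fin 6
  ; order    = 6
  ; size     = 6
  ; vertex↔  = ↔-id _
  ; edge↔    = ↔-id _
  ; ends     = λ i → i , next i
  ; loopless = toWitness {a? = all? λ i → ¬? (i ≟ next i)} _
  ; simple   = toWitness
      {a? = all? λ i → all? λ j →
        ((i ≟ j ×-dec next i ≟ next j) ⊎-dec (i ≟ next j ×-dec next i ≟ j))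
        →-dec (i ≟ j)} _
  }

infixr 7 _copiesOf_

_copiesOf_ : ℕ → Graph → Graph
m copiesOf G = record
  { Vertex   = Fin m × Vertex G
  ; Edge     = Fin m × Edge G
  ; order    = m * order G
  ; size     = m * size G
  ; vertex↔  = ↔-sym *↔× ↔-∘ (↔-id _ ×-↔ vertex↔ G)
  ; edge↔    = ↔-sym *↔× ↔-∘ (↔-id _ ×-↔ edge↔ G)
  ; ends     = λ (c , e) → (c , proj₁ (ends G e)) , (c , proj₂ (ends G e))
  ; loopless = λ (_ , e) eq → loopless G e (cong proj₂ eq)
  ; simple   = λ (_ , e) (_ , e′) → λ where
      (inj₁ (p , q)) → cong₂ _,_ (cong proj₁ p)
        (simple G e e′ (inj₁ (cong proj₂ p , cong proj₂ q)))
      (inj₂ (p , q)) → cong₂ _,_ (cong proj₁ p)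
        (simple G e e′ (inj₂ (cong proj₂ p , cong proj₂ q)))
  }

attachPendants : (G : Graph) → Vertex G → ℕ → Graph
attachPendants G v s = record
  { Vertex   = Vertex G ⊎ Fin s
  ; Edge     = Edge G ⊎ Fin s
  ; order    = order G + s
  ; size     = size G + s
  ; vertex↔  = ↔-sym +↔⊎ ↔-∘ (vertex↔ G ⊎-↔ ↔-id _)
  ; edge↔    = ↔-sym +↔⊎ ↔-∘ (edge↔ G ⊎-↔ ↔-id _)
  ; ends     = ends′
  ; loopless = loopless′
  ; simple   = simple′
  }
  where
  ends′ : Edge G ⊎ Fin s → (Vertex G ⊎ Fin s) × (Vertex G ⊎ Fin s)
  ends′ (inj₁ e) = inj₁ (proj₁ (ends G e)) , inj₁ (proj₂ (ends G e))
  ends′ (inj₂ j) = inj₁ v , inj₂ j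

  loopless′ : ∀ e → proj₁ (ends′ e) ≢ proj₂ (ends′ e)
  loopless′ (inj₁ e) eq = loopless G e (inj₁-injective eq)
  loopless′ (inj₂ j) ()

  simple′ : ∀ e e′ → SamePair (ends′ e) (ends′ e′) → e ≡ e′
  simple′ (inj₁ e) (inj₁ e′) (inj₁ (p , q)) =
    cong inj₁ (simple G e e′ (inj₁ (inj₁-injective p , inj₁-injective q)))
  simple′ (inj₁ e) (inj₁ e′) (inj₂ (p , q)) =
    cong inj₁ (simple G e e′ (inj₂ (inj₁-injective p , inj₁-injective q)))
  simple′ (inj₁ e) (inj₂ j) (inj₁ (_ , ()))
  simple′ (inj₁ e) (inj₂ j) (inj₂ (() , _))
  simple′ (inj₂ j) (inj₁ e) (inj₁ (_ , ()))
  simple′ (inj₂ j) (inj₁ e) (inj₂ (_ , ()))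
  simple′ (inj₂ i) (inj₂ j) (inj₁ (_ , q)) = cong inj₂ (inj₂-injective q)
  simple′ (inj₂ i) (inj₂ j) (inj₂ (() , _))

{-# OPTIONS --safe #-}
-- Lower bound: the s + 2 edges at the hub v have pairwise distinct weights, all different
-- from the weight of v.
--
-- Upper bound: put N = 12m.  If the labels around a hexagon are, in cyclic order,
--   t, u + 2, t + 1, u, t + 2, u + 1   with t + u = N − 1,
-- then consecutive sums run through N + 1, N + 2, N, N + 1, N + 2, N.  The numbers 1, …, N
-- split into 2m such sextuples, one for the vertices and one for the edges of each copy of
-- C₆; correctly aligned they give a labelling of mC₆ with weights N, N + 1, N + 2 in which
-- v has label 1 and lies on edges of weights N and N + 1.  The pendant vertices get the
-- labels N + 1, N + 3, …, so the pendant edges have the weights N + 2, N + 4, …, N + 2s.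
-- These numbers are also the unused labels; assigning them to the pendant edges by a
-- derangement (here s ≥ 2 is needed) makes every pendant vertex differ from its edge.
-- The only further weight is that of v, which exceeds all others.
module Submission where

open import Defs
open import Data.Fin.Base using (Fin; cast; fromℕ<; zero; suc; toℕ; fromℕ; inject₁; opposite; combine; _↑ˡ_; _↑ʳ_)
open import Data.Fin.Patterns using (0F; 1F; 2F; 3F; 4F; 5F)
open import Data.Fin.Permutation using (Permutation′; cast-id; reverse; transpose)
open import Data.Fin.Properties using (+↔⊎; *↔×; all?; injective⇒≤; opposite-prop; toℕ-cast; toℕ-fromℕ<; toℕ-combine; toℕ-injective; toℕ-inject₁; toℕ<n; toℕ-↑ˡ; toℕ-↑ʳ; _≟_)
open import Data.Fin.Relation.Unary.Top using (view; view-fromℕ; view-inject₁; ‵fromℕ; ‵inject₁)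
open import Data.List.Base using (List; []; _∷_; [_]; map; length; lookup; allFin; _++_)
open import Data.List.Extrema.Nat using (max≤v⁺; v≤max⁺)
open import Data.List.Membership.Propositional using (_∈_)
open import Data.List.Membership.Propositional.Properties using (∈-allFin; ∈-deduplicate⁺; ∈-deduplicate⁻; ∈-filter⁺; ∈-filter⁻; ∈-lookup; ∈-map⁺; ∈-map⁻; ∈-++⁺ˡ; ∈-++⁺ʳ; ∈-++⁻)
open import Data.List.Membership.Propositional.Properties.WithK using (unique∧set⇒bag)
open import Data.List.Properties using (length-++; length-map; length-tabulate)
open import Data.List.Relation.Binary.BagAndSetEquality using (∼bag⇒↭)
open import Data.List.Relation.Binary.Permutation.Propositional using (_↭_; ↭-refl; ↭-swap; ↭-trans)
open import Data.List.Relation.Binary.Permutation.Propositional.Properties using (map⁺; ++⁺ʳ; ↭-length)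
open import Data.List.Relation.Binary.Subset.Propositional using (_⊆_)
open import Data.List.Relation.Unary.All as All using (All; []; _∷_)
open import Data.List.Relation.Unary.All.Properties using (all-filter)
open import Data.List.Relation.Unary.AllPairs using ([]; _∷_)
open import Data.List.Relation.Unary.Any as Any using (Any; here; there; index)
open import Data.List.Relation.Unary.Any.Properties using (lookup-index)
open import Data.List.Relation.Unary.Unique.DecPropositional.Properties using (deduplicate-!)
open import Data.List.Relation.Unary.Unique.Propositional using (Unique)
open import Data.List.Relation.Unary.Unique.Propositional.Properties as Unique using (allFin⁺)
open import Data.Nat.Base using (ℕ; zero; suc; _+_; _*_; _≤_; _<_; z≤n; s≤s)
open import Data.Nat.ListAction using (sum)
open import Data.Nat.ListAction.Properties using (sum-↭)
open import Data.Nat.Tactic.RingSolver using (solve-∀)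
open import Data.Product.Base using (_×_; _,_; proj₁; proj₂; ∃-syntax; Σ-syntax)
open import Data.Product.Algebra using (×-distribˡ-⊎; ×-distribʳ-⊎)
open import Data.Product.Function.NonDependent.Propositional using (_×-↔_)
open import Data.Sum.Base using (_⊎_; inj₁; inj₂; [_,_]′)
open import Data.Sum.Function.Propositional using (_⊎-↔_)
open import Data.Sum.Properties using (inj₁-injective; inj₂-injective)
open import Function.Base using (_∘_; id)
open import Function.Bundles using (_↔_; Inverse; mk↔ₛ′; mk⇔)
open import Function.Construct.Composition using () renaming (_↔-∘_ to infixr 9 _∘↔_)
open import Function.Construct.Identity using (↔-id)
open import Function.Construct.Symmetry using (↔-sym)
open import Function.Properties.Inverse using (↔⇒⤖)
open import Level using (0ℓ)
open import Relation.Binary.PropositionalEquality using (_≡_; _≢_; refl; sym; trans; cong; cong₂; subst; subst₂; ≢-sym; module ≡-Reasoning)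
open import Relation.Nullary using (yes; no; contradiction)
open import Relation.Nullary.Decidable using (dec-true; toWitness; ¬?)
import Data.Nat.Properties as ℕ

open Graph
open Inverse using (to; from; strictlyInverseˡ; strictlyInverseʳ)

-- Lists without repetitions.

module _ {A : Set} where

  unique-lookup-injective : {xs : List A} → Unique xs → ∀ {i j} → lookup xs i ≡ lookup xs j → i ≡ j
  unique-lookup-injective (_  ∷ _)   {zero}  {zero}  _  = refl
  unique-lookup-injective (x∉ ∷ _)   {zero}  {suc j} eq = contradiction eq (All.lookup x∉ (∈-lookup j))
  unique-lookup-injective (x∉ ∷ _)   {suc i} {zero}  eq = contradiction (sym eq) (All.lookup x∉ (∈-lookup i))
  unique-lookup-injective (_  ∷ xs!) {suc i} {suc j} eq = cong suc (unique-lookup-injective xs! eq)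

  -- Pigeonhole: sending each position of `xs` to a position of the same element in `ys` is
  -- injective because `xs` has no repetitions.
  unique-⊆⇒length-≤ : {xs ys : List A} → Unique xs → xs ⊆ ys → length xs ≤ length ys
  unique-⊆⇒length-≤ {xs} {ys} xs! xs⊆ys = injective⇒≤ {f = λ i → index (member i)} injective
    where
    member : ∀ i → lookup xs i ∈ ys
    member i = xs⊆ys (∈-lookup i)

    injective : ∀ {i j} → index (member i) ≡ index (member j) → i ≡ j
    injective {i} {j} eq = unique-lookup-injective xs!
      (trans (lookup-index (member i)) (trans (cong (lookup ys) eq) (sym (lookup-index (member j)))))

  -- Separation is asked only of elements satisfying `P`, because edge weights are known to differ
  -- only among edges that share a vertex.
  unique-map : {B : Set} {P : A → Set} {f : A → B} →
    (∀ {x y} → P x → P y → x ≢ y → f x ≢ f y) →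
    ∀ {xs} → All P xs → Unique xs → Unique (map f xs)
  unique-map f-inj []         []         = []
  unique-map {P = P} {f} f-inj (px ∷ pxs) (x∉ ∷ xs!) = go pxs x∉ ∷ unique-map f-inj pxs xs!
    where
    go : ∀ {ys} → All P ys → All (_ ≢_) ys → All (_ ≢_) (map f ys)
    go []         []         = []
    go (py ∷ pys) (x≢y ∷ x∉) = f-inj px py x≢y ∷ go pys x∉

∈⇒≤sum : ∀ {n ns} → n ∈ ns → n ≤ sum ns
∈⇒≤sum {ns = n ∷ ns} (here refl) = ℕ.m≤m+n n (sum ns)
∈⇒≤sum {ns = n ∷ ns} (there n∈)  = ℕ.≤-trans (∈⇒≤sum n∈) (ℕ.m≤n+m (sum ns) n)

-- Incidence, maximum degree and number of weights in an arbitrary graph.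

module _ (G : Graph) where

  private
    complete : {A : Set} {n : ℕ} (A↔Fin : A ↔ Fin n) → ∀ x → x ∈ map (from A↔Fin) (allFin n)
    complete A↔Fin x = subst (_∈ _) (strictlyInverseʳ A↔Fin x) (∈-map⁺ _ (∈-allFin (to A↔Fin x)))

  ∈-vertices : ∀ x → x ∈ vertices G
  ∈-vertices = complete (vertex↔ G)

  ∈-edges : ∀ e → e ∈ edges G
  ∈-edges = complete (edge↔ G)

  edges-unique : Unique (edges G)
  edges-unique = Unique.map⁺ (λ eq → trans (sym (strictlyInverseˡ (edge↔ G) _))
    (trans (cong (to (edge↔ G)) eq) (strictlyInverseˡ (edge↔ G) _))) (allFin⁺ (size G))

  incidentEdges-unique : ∀ x → Unique (incidentEdges G x)
  incidentEdges-unique x = Unique.filter⁺ (_∈ₑ?_ G x) edges-unique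

  ∈-incidentEdges⁺ : ∀ {x e} → _∈ₑ_ G x e → e ∈ incidentEdges G x
  ∈-incidentEdges⁺ {x} = ∈-filter⁺ (_∈ₑ?_ G x) (∈-edges _)

  ∈-incidentEdges⁻ : ∀ {x e} → e ∈ incidentEdges G x → _∈ₑ_ G x e
  ∈-incidentEdges⁻ {x} = proj₂ ∘ ∈-filter⁻ (_∈ₑ?_ G x) {xs = edges G}

  -- Both lists are free of repetitions, so equal membership makes them permutations of each other.
  -- Degrees and vertex weights do not depend on the order of the edges.
  incidentEdges-↭ : ∀ {x es} → Unique es →
    (∀ {e} → _∈ₑ_ G x e → e ∈ es) → (∀ {e} → e ∈ es → _∈ₑ_ G x e) →
    incidentEdges G x ↭ es
  incidentEdges-↭ es! sound complete = ∼bag⇒↭ (unique∧set⇒bag (incidentEdges-unique _) es!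
    (mk⇔ (sound ∘ ∈-incidentEdges⁻) (∈-incidentEdges⁺ ∘ complete)))

  degree-maximal⇒Δ : ∀ x → (∀ y → degree G y ≤ degree G x) → Δ G ≡ degree G x
  degree-maximal⇒Δ x maximal = ℕ.≤-antisym
    -- `z≤n` takes care of the default value 0 in `max`.
    (max≤v⁺ z≤n (All.tabulate bound))
    (v≤max⁺ 0 _ (inj₂ (lose (∈-map⁺ (degree G) (∈-vertices x)))))
    where
    bound : ∀ {d} → d ∈ map (degree G) (vertices G) → d ≤ degree G x
    bound d∈ with y , _ , refl ← ∈-map⁻ (degree G) d∈ = maximal y

    lose : ∀ {d ds} → d ∈ ds → Any (d ≤_) ds
    lose = Any.map ℕ.≤-reflexive

  module _ (f : Labeling G) where

    weights : List ℕ
    weights = map (vertexWeight G f) (vertices G) ++ map (edgeWeight G f) (edges G)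

    vertexWeight-∈ : ∀ x → vertexWeight G f x ∈ weights
    vertexWeight-∈ x = ∈-++⁺ˡ (∈-map⁺ _ (∈-vertices x))

    edgeWeight-∈ : ∀ e → edgeWeight G f e ∈ weights
    edgeWeight-∈ e = ∈-++⁺ʳ (map (vertexWeight G f) (vertices G)) (∈-map⁺ _ (∈-edges e))

    numberOfWeights-≤ : ∀ ws → (∀ x → vertexWeight G f x ∈ ws) → (∀ e → edgeWeight G f e ∈ ws) →
      numberOfWeights G f ≤ length ws
    numberOfWeights-≤ ws vertex∈ edge∈ = unique-⊆⇒length-≤ (deduplicate-! ℕ._≟_ weights)
      (λ w∈ → [ fromVertex , fromEdge ]′
        (∈-++⁻ (map (vertexWeight G f) (vertices G)) (∈-deduplicate⁻ ℕ._≟_ weights w∈)))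
      where
      fromVertex : ∀ {w} → w ∈ map (vertexWeight G f) (vertices G) → w ∈ ws
      fromVertex w∈ with x , _ , refl ← ∈-map⁻ _ w∈ = vertex∈ x

      fromEdge : ∀ {w} → w ∈ map (edgeWeight G f) (edges G) → w ∈ ws
      fromEdge w∈ with e , _ , refl ← ∈-map⁻ _ w∈ = edge∈ e

    -- The edges at x are pairwise adjacent, so they and x carry distinct weights.
    degree<numberOfWeights : IsLocalTotalAntimagic G f → ∀ x → degree G x < numberOfWeights G f
    degree<numberOfWeights antimagic x = subst (λ d → suc d ≤ numberOfWeights G f)
      (length-map (edgeWeight G f) (incidentEdges G x))
      (unique-⊆⇒length-≤ (x∉ ∷ distinct) (∈-deduplicate⁺ ℕ._≟_ ∘ ⊆weights))
      where
      open IsLocalTotalAntimagic antimagic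

      incident : All (_∈ₑ_ G x) (incidentEdges G x)
      incident = all-filter (_∈ₑ?_ G x) (edges G)

      distinct : Unique (map (edgeWeight G f) (incidentEdges G x))
      distinct = unique-map (λ x∈e x∈e′ e≢e′ → edges-distinct _ _ (e≢e′ , x , x∈e , x∈e′))
        incident (incidentEdges-unique x)

      x∉ : All (vertexWeight G f x ≢_) (map (edgeWeight G f) (incidentEdges G x))
      x∉ = All.tabulate λ w∈ eq → case-∈ (∈-map⁻ (edgeWeight G f) w∈) eq
        where
        case-∈ : ∀ {w} → ∃[ e ] (e ∈ incidentEdges G x × w ≡ edgeWeight G f e) → vertexWeight G f x ≢ w
        case-∈ (e , e∈ , refl) = incidence-distinct x e (∈-incidentEdges⁻ e∈)

      ⊆weights : vertexWeight G f x ∷ map (edgeWeight G f) (incidentEdges G x) ⊆ weights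
      ⊆weights (here refl) = vertexWeight-∈ x
      ⊆weights (there w∈) with e , _ , refl ← ∈-map⁻ (edgeWeight G f) w∈ = edgeWeight-∈ e

-- Incident edges in disjoint copies and after attaching pendant edges.

module _ (m : ℕ) (G : Graph) where

  incidentEdges-copiesOf : ∀ k x →
    incidentEdges (m copiesOf G) (k , x) ↭ map (k ,_) (incidentEdges G x)
  incidentEdges-copiesOf k x = incidentEdges-↭ (m copiesOf G)
    (Unique.map⁺ (λ { refl → refl }) (incidentEdges-unique G x)) sound complete
    where
    sound : ∀ {e} → _∈ₑ_ (m copiesOf G) (k , x) e → e ∈ map (k ,_) (incidentEdges G x)
    sound (inj₁ refl) = ∈-map⁺ _ (∈-incidentEdges⁺ G (inj₁ refl))
    sound (inj₂ refl) = ∈-map⁺ _ (∈-incidentEdges⁺ G (inj₂ refl))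

    complete : ∀ {e} → e ∈ map (k ,_) (incidentEdges G x) → _∈ₑ_ (m copiesOf G) (k , x) e
    complete e∈ with e , e∈ , refl ← ∈-map⁻ _ e∈ with ∈-incidentEdges⁻ G e∈
    ... | inj₁ refl = inj₁ refl
    ... | inj₂ refl = inj₂ refl

module _ (G : Graph) (v : Vertex G) (s : ℕ) where

  private
    H : Graph
    H = attachPendants G v s

    lift-unique : ∀ x → Unique {A = Edge H} (map inj₁ (incidentEdges G x))
    lift-unique x = Unique.map⁺ inj₁-injective (incidentEdges-unique G x)

  ∈ₑ-inj₁⁺ : ∀ {x e} → _∈ₑ_ G x e → _∈ₑ_ H (inj₁ x) (inj₁ e)
  ∈ₑ-inj₁⁺ (inj₁ refl) = inj₁ refl
  ∈ₑ-inj₁⁺ (inj₂ refl) = inj₂ refl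

  ∈ₑ-inj₁⁻ : ∀ {x e} → _∈ₑ_ H (inj₁ x) (inj₁ e) → _∈ₑ_ G x e
  ∈ₑ-inj₁⁻ (inj₁ refl) = inj₁ refl
  ∈ₑ-inj₁⁻ (inj₂ refl) = inj₂ refl

  incidentEdges-pendant : ∀ j → incidentEdges H (inj₂ j) ↭ [ inj₂ j ]
  incidentEdges-pendant j = incidentEdges-↭ H ([] ∷ []) sound λ { (here refl) → inj₂ refl }
    where
    sound : ∀ {e} → _∈ₑ_ H (inj₂ j) e → e ∈ [ inj₂ j ]
    sound {inj₁ e} (inj₁ ())
    sound {inj₁ e} (inj₂ ())
    sound {inj₂ _} (inj₂ refl) = here refl

  incidentEdges-other : ∀ {x} → x ≢ v → incidentEdges H (inj₁ x) ↭ map inj₁ (incidentEdges G x)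
  incidentEdges-other {x} x≢v = incidentEdges-↭ H (lift-unique x) sound complete
    where
    sound : ∀ {e} → _∈ₑ_ H (inj₁ x) e → e ∈ map inj₁ (incidentEdges G x)
    sound {inj₁ e} x∈e         = ∈-map⁺ inj₁ (∈-incidentEdges⁺ G (∈ₑ-inj₁⁻ x∈e))
    sound {inj₂ _} (inj₁ refl) = contradiction refl x≢v

    complete : ∀ {e} → e ∈ map inj₁ (incidentEdges G x) → _∈ₑ_ H (inj₁ x) e
    complete e∈ with e , e∈ , refl ← ∈-map⁻ inj₁ e∈ = ∈ₑ-inj₁⁺ (∈-incidentEdges⁻ G e∈)

  incidentEdges-hub : incidentEdges H (inj₁ v) ↭ map inj₁ (incidentEdges G v) ++ map inj₂ (allFin s)
  incidentEdges-hub = incidentEdges-↭ H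
    (Unique.++⁺ (lift-unique v) (Unique.map⁺ inj₂-injective (allFin⁺ s)) disjoint) sound complete
    where
    disjoint : ∀ {e} → e ∈ map inj₁ (incidentEdges G v) × e ∈ map inj₂ (allFin s) → _
    disjoint (e∈₁ , e∈₂) with _ , _ , refl ← ∈-map⁻ inj₁ e∈₁ with _ , _ , () ← ∈-map⁻ inj₂ e∈₂

    sound : ∀ {e} → _∈ₑ_ H (inj₁ v) e → e ∈ map inj₁ (incidentEdges G v) ++ map inj₂ (allFin s)
    sound {inj₁ e} v∈e = ∈-++⁺ˡ (∈-map⁺ inj₁ (∈-incidentEdges⁺ G (∈ₑ-inj₁⁻ v∈e)))
    sound {inj₂ j} _   = ∈-++⁺ʳ (map inj₁ (incidentEdges G v)) (∈-map⁺ inj₂ (∈-allFin j))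

    complete : ∀ {e} → e ∈ map inj₁ (incidentEdges G v) ++ map inj₂ (allFin s) → _∈ₑ_ H (inj₁ v) e
    complete e∈ with ∈-++⁻ (map inj₁ (incidentEdges G v)) e∈
    ... | inj₁ e∈₁ with e , e∈ , refl ← ∈-map⁻ inj₁ e∈₁ = ∈ₑ-inj₁⁺ (∈-incidentEdges⁻ G e∈)
    ... | inj₂ e∈₂ with _ , _ , refl ← ∈-map⁻ inj₂ e∈₂ = inj₁ refl

-- The hexagon and its rotations.

incidentEdges-C₆ : ∀ j → incidentEdges C₆ (next j) ↭ j ∷ next j ∷ []
incidentEdges-C₆ 0F = ↭-refl
incidentEdges-C₆ 1F = ↭-refl
incidentEdges-C₆ 2F = ↭-refl
incidentEdges-C₆ 3F = ↭-refl
incidentEdges-C₆ 4F = ↭-refl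
-- Filtering lists the edges in increasing order, so at the wrap-around edge 0 precedes edge 5.
incidentEdges-C₆ 5F = ↭-swap 0F 5F ↭-refl

prev : Fin 6 → Fin 6
prev = next ∘ next ∘ next ∘ next ∘ next

next-prev : ∀ j → next (prev j) ≡ j
next-prev = toWitness {a? = all? λ j → next (prev j) ≟ j} _

prev-next : ∀ j → prev (next j) ≡ j
prev-next = toWitness {a? = all? λ j → prev (next j) ≟ j} _

next↔ : Fin 6 ↔ Fin 6
next↔ = mk↔ₛ′ next prev next-prev prev-next

-- Used with `toℕ i` to bring the hub, at position `i`, to position 0 of its hexagon.
unwind : ℕ → Fin 6 ↔ Fin 6
unwind zero    = ↔-id _
unwind (suc n) = ↔-sym next↔ ∘↔ unwind n

unwind-next : ∀ n j → to (unwind n) (next j) ≡ next (to (unwind n) j)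
unwind-next zero    j = refl
unwind-next (suc n) j = begin
  prev (to (unwind n) (next j))  ≡⟨ cong prev (unwind-next n j) ⟩
  prev (next (to (unwind n) j))  ≡⟨ prev-next _ ⟩
  to (unwind n) j                ≡⟨ next-prev _ ⟨
  next (prev (to (unwind n) j))  ∎
  where open ≡-Reasoning

unwind-self : ∀ i → to (unwind (toℕ i)) i ≡ 0F
unwind-self = toWitness {a? = all? λ i → to (unwind (toℕ i)) i ≟ 0F} _

-- Sextuples of labels and the excess `hue` of their consecutive sums over N.

hue : Fin 6 → ℕ
hue 0F = 1
hue 1F = 2
hue 2F = 0
hue 3F = 1
hue 4F = 2
hue 5F = 0

hue≤2 : ∀ p → hue p ≤ 2
hue≤2 = toWitness {a? = all? λ p → hue p ℕ.≤? 2} _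

-- The values run through 1, 2, 0 with period three, so neither one step nor two steps can repeat a
-- value.
hue-next≢ : ∀ p → hue (next p) ≢ hue p
hue-next≢ = toWitness {a? = all? λ p → ¬? (hue (next p) ℕ.≟ hue p)} _

hue-next²≢ : ∀ p → hue (next (next p)) ≢ hue p
hue-next²≢ = toWitness {a? = all? λ p → ¬? (hue (next (next p)) ℕ.≟ hue p)} _

hue-5 : ∀ p → next p ≡ 0F → hue p ≡ 0
hue-5 5F _ = refl

-- The alternating pattern t, u + 2, t + 1, u, t + 2, u + 1: `inj₁ r` stands for t + r and `inj₂ r`
-- for u + r.
zigzag : Fin 6 ↔ (Fin 3 ⊎ Fin 3)
zigzag = mk↔ₛ′
  (λ { 0F → inj₁ 0F ; 1F → inj₂ 2F ; 2F → inj₁ 1F ; 3F → inj₂ 0F ; 4F → inj₁ 2F ; 5F → inj₂ 1F })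
  (λ { (inj₁ 0F) → 0F ; (inj₂ 2F) → 1F ; (inj₁ 1F) → 2F ; (inj₂ 0F) → 3F ; (inj₁ 2F) → 4F ; (inj₂ 1F) → 5F })
  (λ { (inj₁ 0F) → refl ; (inj₂ 2F) → refl ; (inj₁ 1F) → refl ; (inj₂ 0F) → refl ; (inj₁ 2F) → refl ; (inj₂ 1F) → refl })
  (λ { 0F → refl ; 1F → refl ; 2F → refl ; 3F → refl ; 4F → refl ; 5F → refl })

-- Hexagon h receives the h-th block of three consecutive numbers from below on its
-- even positions and the h-th block from above on its odd positions.
slot : ∀ n → (Fin n × Fin 6) ↔ Fin ((n + n) * 3)
slot n = ↔-sym *↔×
  ∘↔ (↔-sym +↔⊎ ×-↔ ↔-id _)
  ∘↔ ↔-sym (×-distribʳ-⊎ 0ℓ _ _ _)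
  ∘↔ (↔-id _ ⊎-↔ (reverse ×-↔ ↔-id _))
  ∘↔ ×-distribˡ-⊎ 0ℓ _ _ _
  ∘↔ (↔-id _ ×-↔ zigzag)

opposite-sum : ∀ {n} (h : Fin n) → suc (toℕ h + toℕ (opposite h)) ≡ n
opposite-sum h = trans (cong (suc (toℕ h) +_) (opposite-prop h)) (ℕ.m+[n∸m]≡n (toℕ<n h))

module _ {n : ℕ} (h : Fin n) where

  private
    lower upper : Fin 3 → ℕ
    lower r = suc (toℕ (combine (h ↑ˡ n) r))
    upper r = suc (toℕ (combine (n ↑ʳ opposite h) r))

    -- The two blocks lie equally far from the two ends of the range, so their first labels always
    -- add up to N - 1, where N = (n + n) * 3. The offsets contribute `suc k`, which leaves N + k.
    lower+upper : ∀ r r′ k → toℕ r + toℕ r′ ≡ suc k → lower r + upper r′ ≡ (n + n) * 3 + k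
    lower+upper r r′ k r+r′ = ℕ.suc-injective (begin
      suc (lower r + upper r′)
        ≡⟨ cong₂ (λ x y → suc (suc x + suc y)) (toℕ-combine (h ↑ˡ n) r) (toℕ-combine (n ↑ʳ opposite h) r′) ⟩
      suc (suc (3 * toℕ (h ↑ˡ n) + toℕ r) + suc (3 * toℕ (n ↑ʳ opposite h) + toℕ r′))
        ≡⟨ cong₂ (λ x y → suc (suc (3 * x + toℕ r) + suc (3 * y + toℕ r′)))
             (toℕ-↑ˡ h n) (toℕ-↑ʳ n (opposite h)) ⟩
      suc (suc (3 * toℕ h + toℕ r) + suc (3 * (n + toℕ (opposite h)) + toℕ r′))
        ≡⟨ regroup n (toℕ h) (toℕ (opposite h)) (toℕ r) (toℕ r′) ⟩
      (n + suc (toℕ h + toℕ (opposite h))) * 3 + (toℕ r + toℕ r′)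
        ≡⟨ cong₂ (λ x y → (n + x) * 3 + y) (opposite-sum h) r+r′ ⟩
      (n + n) * 3 + suc k
        ≡⟨ ℕ.+-suc _ k ⟩
      suc ((n + n) * 3 + k) ∎)
      where
      open ≡-Reasoning
      regroup : ∀ n a b x y →
        suc (suc (3 * a + x) + suc (3 * (n + b) + y)) ≡ (n + suc (a + b)) * 3 + (x + y)
      regroup = solve-∀

    upper+lower : ∀ r r′ k → toℕ r + toℕ r′ ≡ suc k → upper r′ + lower r ≡ (n + n) * 3 + k
    upper+lower r r′ k r+r′ = trans (ℕ.+-comm (upper r′) (lower r)) (lower+upper r r′ k r+r′)

  slot-sum : ∀ p →
    suc (toℕ (to (slot n) (h , p))) + suc (toℕ (to (slot n) (h , next p))) ≡ (n + n) * 3 + hue p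
  slot-sum 0F = lower+upper 0F 2F 1 refl
  slot-sum 1F = upper+lower 1F 2F 2 refl
  slot-sum 2F = lower+upper 1F 0F 0 refl
  slot-sum 3F = upper+lower 2F 0F 1 refl
  slot-sum 4F = lower+upper 2F 1F 2 refl
  slot-sum 5F = upper+lower 0F 1F 0 refl

-- A derangement, and bijections that sort the elements to be labelled.

shift : ∀ n → Permutation′ (suc n)
shift n = mk↔ₛ′ forth back forth-back back-forth
  where
  forth : Fin (suc n) → Fin (suc n)
  forth zero    = fromℕ n
  forth (suc j) = inject₁ j

  back : Fin (suc n) → Fin (suc n)
  back j with view j
  ... | ‵fromℕ     = zero
  ... | ‵inject₁ i = suc i

  forth-back : ∀ j → forth (back j) ≡ j
  forth-back j with view j
  ... | ‵fromℕ     = refl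
  ... | ‵inject₁ i = refl

  back-forth : ∀ j → back (forth j) ≡ j
  back-forth zero rewrite view-fromℕ n = refl
  back-forth (suc j) rewrite view-inject₁ j = refl

-- At least two points are needed: on a single point the cyclic shift is the identity.
shift-derangement : ∀ n j → to (shift (suc n)) j ≢ j
shift-derangement n zero    ()
shift-derangement n (suc j) eq = ℕ.1+n≢n (trans (cong toℕ (sym eq)) (toℕ-inject₁ j))

derangement : ∀ {n} → 2 ≤ n → Σ[ τ ∈ Permutation′ n ] (∀ j → to τ j ≢ j)
derangement (s≤s (s≤s z≤n)) = shift _ , shift-derangement _

-- The argument only witnesses that `Fin n` is inhabited.
origin : ∀ {n} → Fin n → Fin n
origin {suc n} _ = zero

toℕ-origin : ∀ {n} (i : Fin n) → toℕ (origin i) ≡ 0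
toℕ-origin {suc n} _ = refl

-- Regroups vertices and edges into cycle elements, which take the labels up to N, and pendant
-- elements, which take the rest.
interchange : {A B C D : Set} → ((A ⊎ B) ⊎ (C ⊎ D)) ↔ ((A ⊎ C) ⊎ (B ⊎ D))
interchange = mk↔ₛ′ swap swap swap-involutive swap-involutive
  where
  swap : {A B C D : Set} → (A ⊎ B) ⊎ (C ⊎ D) → (A ⊎ C) ⊎ (B ⊎ D)
  swap (inj₁ (inj₁ a)) = inj₁ (inj₁ a)
  swap (inj₁ (inj₂ b)) = inj₂ (inj₁ b)
  swap (inj₂ (inj₁ c)) = inj₁ (inj₂ c)
  swap (inj₂ (inj₂ d)) = inj₂ (inj₂ d)

  swap-involutive : {A B C D : Set} (x : (A ⊎ B) ⊎ (C ⊎ D)) → swap (swap x) ≡ x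
  swap-involutive (inj₁ (inj₁ _)) = refl
  swap-involutive (inj₁ (inj₂ _)) = refl
  swap-involutive (inj₂ (inj₁ _)) = refl
  swap-involutive (inj₂ (inj₂ _)) = refl

-- The tag becomes the low digit of the label, so pendant vertices and pendant edges receive
-- alternate labels.
tagged : {A : Set} → (A ⊎ A) ↔ (A × Fin 2)
tagged {A} = mk↔ₛ′ [ (_, 0F) , (_, 1F) ]′ untag tag-untag (λ { (inj₁ _) → refl ; (inj₂ _) → refl })
  where
  untag : A × Fin 2 → A ⊎ A
  untag (a , 0F) = inj₁ a
  untag (a , 1F) = inj₂ a

  tag-untag : ∀ x → [ (_, 0F) , (_, 1F) ]′ (untag x) ≡ x
  tag-untag (_ , 0F) = refl
  tag-untag (_ , 1F) = refl

transpose-source : ∀ {n} (i j : Fin n) → to (transpose i j) i ≡ j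
transpose-source i j rewrite dec-true (i ≟ i) refl = refl

-- Degrees and the maximum degree.

incidentEdges-mC₆ : ∀ m k j →
  incidentEdges (m copiesOf C₆) (k , next j) ↭ (k , j) ∷ (k , next j) ∷ []
incidentEdges-mC₆ m k j = ↭-trans (incidentEdges-copiesOf m C₆ k (next j)) (map⁺ (k ,_) (incidentEdges-C₆ j))

degree-mC₆ : ∀ m x → degree (m copiesOf C₆) x ≡ 2
degree-mC₆ m (k , j) = subst (λ l → degree (m copiesOf C₆) (k , l) ≡ 2) (next-prev j)
  (↭-length (incidentEdges-mC₆ m k (prev j)))

module _ (G : Graph) (v : Vertex G) (s : ℕ) where

  degree-hub : degree (attachPendants G v s) (inj₁ v) ≡ degree G v + s
  degree-hub = begin
    degree (attachPendants G v s) (inj₁ v)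
      ≡⟨ ↭-length (incidentEdges-hub G v s) ⟩
    length {A = Edge G ⊎ Fin s} (map inj₁ (incidentEdges G v) ++ map inj₂ (allFin s))
      ≡⟨ length-++ (map inj₁ (incidentEdges G v)) ⟩
    length {A = Edge G ⊎ Fin s} (map inj₁ (incidentEdges G v)) + length {A = Edge G ⊎ Fin s} (map inj₂ (allFin s))
      ≡⟨ cong₂ _+_ (length-map inj₁ (incidentEdges G v)) (length-map inj₂ (allFin s)) ⟩
    degree G v + length (allFin s)
      ≡⟨ cong (degree G v +_) (length-tabulate {n = s} id) ⟩
    degree G v + s ∎
    where open ≡-Reasoning

  degree-other : ∀ {x} → x ≢ v → degree (attachPendants G v s) (inj₁ x) ≡ degree G x
  degree-other {x} x≢v =
    trans (↭-length (incidentEdges-other G v s x≢v)) (length-map inj₁ (incidentEdges G x))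

  degree-pendant : ∀ j → degree (attachPendants G v s) (inj₂ j) ≡ 1
  degree-pendant j = ↭-length (incidentEdges-pendant G v s j)

module _ (m s : ℕ) (v : Vertex (m copiesOf C₆)) where

  private
    G : Graph
    G = attachPendants (m copiesOf C₆) v s

  degree-mC₆-hub : degree G (inj₁ v) ≡ s + 2
  degree-mC₆-hub = trans (degree-hub (m copiesOf C₆) v s)
    (trans (cong (_+ s) (degree-mC₆ m v)) (ℕ.+-comm 2 s))

  Δ-pendants : Δ G ≡ s + 2
  Δ-pendants = trans (degree-maximal⇒Δ G (inj₁ v) maximal) degree-mC₆-hub
    where
    maximal : ∀ x → degree G x ≤ degree G (inj₁ v)
    maximal (inj₁ x) with _≟ᵛ_ (m copiesOf C₆) x v
    ... | yes refl = ℕ.≤-refl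
    ... | no x≢v   = subst₂ _≤_
      (sym (trans (degree-other (m copiesOf C₆) v s x≢v) (degree-mC₆ m x))) (sym degree-mC₆-hub) (ℕ.m≤n+m 2 s)
    maximal (inj₂ j) = subst₂ _≤_
      (sym (degree-pendant (m copiesOf C₆) v s j)) (sym degree-mC₆-hub) (ℕ.m≤n⇒m≤o+n s (s≤s z≤n))

-- The labelling for the upper bound.

module Construction (m s : ℕ) (2≤s : 2 ≤ s) (c : Fin m) (i : Fin 6) where

  n N : ℕ
  n = m + m
  N = (n + n) * 3

  mC₆ G : Graph
  mC₆ = m copiesOf C₆
  G = attachPendants mC₆ (c , i) s

  hub : Vertex G
  hub = inj₁ (c , i)

  τ : Permutation′ s
  τ = proj₁ (derangement 2≤s)

  τ-derangement : ∀ j → to τ j ≢ j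
  τ-derangement = proj₂ (derangement 2≤s)

  -- Brings the copy containing the hub to index 0, whose lower block starts with the label 1.
  copy : Permutation′ m
  copy = transpose c (origin c)

  position : Fin 6 ↔ Fin 6
  position = unwind (toℕ i)

  -- The vertices of copy k take the hexagon (copy k), in which the hub gets the label 1,
  -- and its edges the hexagon m + k, turned by two positions, so that a vertex other than
  -- the hub has the weight of an edge at distance one.
  cycleLabels : ((Fin m × Fin 6) ⊎ (Fin m × Fin 6)) ↔ Fin N
  cycleLabels = slot n
    ∘↔ (↔-sym +↔⊎ ×-↔ ↔-id _)
    ∘↔ ↔-sym (×-distribʳ-⊎ 0ℓ _ _ _)
    ∘↔ ((copy ×-↔ position) ⊎-↔ (↔-id _ ×-↔ (next↔ ∘↔ next↔ ∘↔ position)))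

  pendantLabels : (Fin s ⊎ Fin s) ↔ Fin (s * 2)
  pendantLabels = ↔-sym *↔× ∘↔ tagged ∘↔ (↔-id _ ⊎-↔ τ)

  N+2s≡order+size : N + s * 2 ≡ order G + size G
  N+2s≡order+size = regroup m s
    where
    regroup : ∀ m s → ((m + m) + (m + m)) * 3 + s * 2 ≡ (m * 6 + s) + (m * 6 + s)
    regroup = solve-∀

  -- These numbers play two parts: the weight of pendant edge `j`, and the label of the pendant edge
  -- that `τ` sends to `j`.
  pendantWeight : Fin s → ℕ
  pendantWeight j = N + (2 + 2 * toℕ j)

  pendantWeight-least : ∃[ j ] pendantWeight j ≡ N + 2
  pendantWeight-least = fromℕ< 0<s , cong (λ x → N + (2 + 2 * x)) (toℕ-fromℕ< 0<s)
    where
    0<s : 0 < s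
    0<s = ℕ.<-trans (s≤s z≤n) 2≤s

  cycleWeight : Fin 6 → ℕ
  cycleWeight j = N + hue (to position j)

  resize : Fin (N + s * 2) → Fin (order G + size G)
  resize = cast N+2s≡order+size

  hexagonLabel : Fin n → Fin 6 → ℕ
  hexagonLabel h p = suc (toℕ (to (slot n) (h , p)))

  opaque

    -- Kept opaque, so that everything below relies only on the four label equations of this block.
    f : Labeling G
    f = ↔⇒⤖ (cast-id N+2s≡order+size ∘↔ ↔-sym +↔⊎ ∘↔ (cycleLabels ⊎-↔ pendantLabels) ∘↔ interchange)

    private
      toℕ-resize : ∀ x → toℕ (resize x) ≡ toℕ x
      toℕ-resize = toℕ-cast N+2s≡order+size

      cycleLabel : ∀ (z : Fin N) → 1 + toℕ (resize (z ↑ˡ (s * 2))) ≡ 1 + toℕ z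
      cycleLabel z = cong suc (trans (toℕ-resize (z ↑ˡ (s * 2))) (toℕ-↑ˡ z (s * 2)))

      pendantLabel : ∀ (j : Fin s) (b : Fin 2) →
        suc (toℕ (resize (N ↑ʳ combine j b))) ≡ N + (suc (toℕ b) + 2 * toℕ j)
      pendantLabel j b = begin
        suc (toℕ (resize (N ↑ʳ combine j b)))
          ≡⟨ cong suc (toℕ-resize (N ↑ʳ combine j b)) ⟩
        suc (toℕ (N ↑ʳ combine j b))
          ≡⟨ cong suc (toℕ-↑ʳ N (combine j b)) ⟩
        suc (N + toℕ (combine j b))
          ≡⟨ cong (λ x → suc (N + x)) (toℕ-combine j b) ⟩
        suc (N + (2 * toℕ j + toℕ b))
          ≡⟨ regroup N (2 * toℕ j) (toℕ b) ⟩
        N + (suc (toℕ b) + 2 * toℕ j) ∎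
        where
        open ≡-Reasoning
        regroup : ∀ N x y → suc (N + (x + y)) ≡ N + (suc y + x)
        regroup = solve-∀

    label-vertex : ∀ k j →
      label G f (inj₁ (inj₁ (k , j))) ≡ hexagonLabel (to copy k ↑ˡ m) (to position j)
    label-vertex k j = cycleLabel (to (slot n) (to copy k ↑ˡ m , to position j))

    label-edge : ∀ k j →
      label G f (inj₂ (inj₁ (k , j))) ≡ hexagonLabel (m ↑ʳ k) (next (next (to position j)))
    label-edge k j = cycleLabel (to (slot n) (m ↑ʳ k , next (next (to position j))))

    label-pendant : ∀ j → label G f (inj₁ (inj₂ j)) ≡ N + (1 + 2 * toℕ j)
    label-pendant j = pendantLabel j 0F

    label-pendantEdge : ∀ j → label G f (inj₂ (inj₂ j)) ≡ pendantWeight (to τ j)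
    label-pendantEdge j = pendantLabel (to τ j) 1F

  label-hub : label G f (inj₁ hub) ≡ 1
  label-hub = trans (label-vertex c i)
    (trans
    (cong₂ (λ k p → hexagonLabel (k ↑ˡ m) p) (transpose-source c (origin c)) (unwind-self i))
    (cong suc (begin
      toℕ (combine ((origin c ↑ˡ m) ↑ˡ n) 0F)     ≡⟨ toℕ-combine ((origin c ↑ˡ m) ↑ˡ n) 0F ⟩
      3 * toℕ ((origin c ↑ˡ m) ↑ˡ n) + 0          ≡⟨ cong (λ x → 3 * x + 0) (toℕ-↑ˡ (origin c ↑ˡ m) n) ⟩
      3 * toℕ (origin c ↑ˡ m) + 0                 ≡⟨ cong (λ x → 3 * x + 0) (toℕ-↑ˡ (origin c) m) ⟩
      3 * toℕ (origin c) + 0                      ≡⟨ cong (λ x → 3 * x + 0) (toℕ-origin c) ⟩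
      0 ∎)))
    where open ≡-Reasoning

  -- The weights under this labelling.

  edgeWeight-cycle : ∀ k j → edgeWeight G f (inj₁ (k , j)) ≡ cycleWeight j
  edgeWeight-cycle k j = begin
    edgeWeight G f (inj₁ (k , j))
      ≡⟨ cong₂ _+_ (label-vertex k j) (label-vertex k (next j)) ⟩
    slotLabel (to position j) + slotLabel (to position (next j))
      ≡⟨ cong (λ p → slotLabel (to position j) + slotLabel p) (unwind-next (toℕ i) j) ⟩
    slotLabel (to position j) + slotLabel (next (to position j))
      ≡⟨ slot-sum (to copy k ↑ˡ m) (to position j) ⟩
    cycleWeight j ∎
    where
    open ≡-Reasoning
    slotLabel : Fin 6 → ℕ
    slotLabel = hexagonLabel (to copy k ↑ˡ m)

  -- The label 1 of the hub raises the label N + 1 + 2j of the pendant vertex by one.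
  edgeWeight-pendant : ∀ j → edgeWeight G f (inj₂ j) ≡ pendantWeight j
  edgeWeight-pendant j = trans (cong₂ _+_ label-hub (label-pendant j)) (sym (ℕ.+-suc N _))

  vertexWeight-pendant : ∀ j → vertexWeight G f (inj₂ j) ≡ pendantWeight (to τ j)
  vertexWeight-pendant j = trans
    (sum-↭ (map⁺ (label G f ∘ inj₂) (incidentEdges-pendant mC₆ (c , i) s j)))
    (trans (ℕ.+-identityʳ _) (label-pendantEdge j))

  -- Away from the hub the weight is the sum of the labels of two consecutive edges. Since the edge
  -- hexagon is turned by two positions, this sum is the one found two places further on.
  vertexWeight-next : ∀ k j → (k , next j) ≢ (c , i) →
    vertexWeight G f (inj₁ (k , next j)) ≡ cycleWeight (next (next j))
  vertexWeight-next k j ≢hub = begin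
    vertexWeight G f (inj₁ (k , next j))
      ≡⟨ sum-↭ (map⁺ (label G f ∘ inj₂) (↭-trans (incidentEdges-other mC₆ (c , i) s ≢hub)
           (map⁺ inj₁ (incidentEdges-mC₆ m k j)))) ⟩
    label G f (inj₂ (inj₁ (k , j))) + (label G f (inj₂ (inj₁ (k , next j))) + 0)
      ≡⟨ cong₂ _+_ (label-edge k j) (trans (ℕ.+-identityʳ _) (label-edge k (next j))) ⟩
    slotLabel (next (next (to position j))) + slotLabel (next (next (to position (next j))))
      ≡⟨ cong (λ p → slotLabel (next (next (to position j))) + slotLabel (next (next p))) (unwind-next (toℕ i) j) ⟩
    slotLabel (next (next (to position j))) + slotLabel (next (next (next (to position j))))
      ≡⟨ slot-sum (m ↑ʳ k) (next (next (to position j))) ⟩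
    N + hue (next (next (to position j)))
      ≡⟨ cong (λ p → N + hue (next p)) (unwind-next (toℕ i) j) ⟨
    N + hue (next (to position (next j)))
      ≡⟨ cong (λ p → N + hue p) (unwind-next (toℕ i) (next j)) ⟨
    cycleWeight (next (next j)) ∎
    where
    open ≡-Reasoning
    slotLabel : Fin 6 → ℕ
    slotLabel = hexagonLabel (m ↑ʳ k)

  vertexWeight-cycle : ∀ k j → (k , j) ≢ (c , i) → vertexWeight G f (inj₁ (k , j)) ≡ cycleWeight (next j)
  vertexWeight-cycle k j = subst
    (λ l → (k , l) ≢ (c , i) → vertexWeight G f (inj₁ (k , l)) ≡ cycleWeight (next l))
    (next-prev j) (vertexWeight-next k (prev j))

  -- As `τ` is surjective, `pendantWeight j` is the label of some pendant edge and so a summand of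
  -- the weight of the hub. The cycle edges at the hub make the inequality strict.
  pendantWeight<hub : ∀ j → pendantWeight j < vertexWeight G f hub
  pendantWeight<hub j = begin-strict
    pendantWeight j
      ≡⟨ cong pendantWeight (strictlyInverseˡ τ j) ⟨
    pendantWeight (to τ (from τ j))
      ≡⟨ label-pendantEdge (from τ j) ⟨
    g (inj₂ (from τ j))
      ≤⟨ ∈⇒≤sum (∈-map⁺ g (∈-map⁺ inj₂ (∈-allFin (from τ j)))) ⟩
    sum (map g (map inj₂ (allFin s)))
      <⟨ ℕ.m<n+m _ (s≤s z≤n) ⟩
    g (inj₁ (c , prev i)) + sum (map g (map inj₂ (allFin s)))
      ≤⟨ ℕ.+-monoʳ-≤ (g (inj₁ (c , prev i))) (ℕ.m≤n+m _ (g (inj₁ (c , next (prev i))))) ⟩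
    g (inj₁ (c , prev i)) + (g (inj₁ (c , next (prev i))) + sum (map g (map inj₂ (allFin s))))
      ≡⟨ sum-↭ (map⁺ g (↭-trans (incidentEdges-hub mC₆ (c , i) s) (++⁺ʳ _ (map⁺ inj₁ atHub)))) ⟨
    vertexWeight G f hub ∎
    where
    open ℕ.≤-Reasoning
    g : Edge G → ℕ
    g = label G f ∘ inj₂

    atHub : incidentEdges mC₆ (c , i) ↭ (c , prev i) ∷ (c , next (prev i)) ∷ []
    atHub = subst (λ l → incidentEdges mC₆ (c , l) ↭ (c , prev i) ∷ (c , next (prev i)) ∷ [])
      (next-prev i) (incidentEdges-mC₆ m c (prev i))

  -- The labelling is local total antimagic.

  pendantWeight-injective : ∀ j l → pendantWeight j ≡ pendantWeight l → j ≡ l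
  pendantWeight-injective j l eq = toℕ-injective
    (ℕ.*-cancelˡ-≡ _ _ 2 (ℕ.+-cancelˡ-≡ 2 _ _ (ℕ.+-cancelˡ-≡ N _ _ eq)))

  hub≢pendantWeight : ∀ j → vertexWeight G f hub ≢ pendantWeight j
  hub≢pendantWeight j = ≢-sym (ℕ.<⇒≢ (pendantWeight<hub j))

  -- Cycle weights are at most N + 2, the least pendant weight, which the hub exceeds.
  hub≢cycleWeight : ∀ j → vertexWeight G f hub ≢ cycleWeight j
  hub≢cycleWeight j = ≢-sym (ℕ.<⇒≢ (ℕ.≤-<-trans (ℕ.+-monoʳ-≤ N (hue≤2 (to position j)))
    (subst (_< vertexWeight G f hub) (proj₂ pendantWeight-least) (pendantWeight<hub (proj₁ pendantWeight-least)))))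

  cycleWeight-next≢ : ∀ j → cycleWeight (next j) ≢ cycleWeight j
  cycleWeight-next≢ j eq = hue-next≢ (to position j)
    (trans (cong hue (sym (unwind-next (toℕ i) j))) (ℕ.+-cancelˡ-≡ N _ _ eq))

  cycleWeight-next²≢ : ∀ j → cycleWeight (next (next j)) ≢ cycleWeight j
  cycleWeight-next²≢ j eq = hue-next²≢ (to position j)
    (trans (cong hue (sym (trans (unwind-next (toℕ i) (next j)) (cong next (unwind-next (toℕ i) j)))))
      (ℕ.+-cancelˡ-≡ N _ _ eq))

  -- The cycle edges at the hub sit at positions 0 and 5 and weigh N + 1 and N. Thus the value N +
  -- 2, shared by cycle edges and a pendant edge, causes no clash at the hub.
  cycleWeight<pendantWeight : ∀ {k j} → _∈ₑ_ mC₆ (c , i) (k , j) → ∀ l → cycleWeight j < pendantWeight l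
  cycleWeight<pendantWeight {k} {j} hub∈ l = ℕ.+-monoʳ-< N (ℕ.<-≤-trans (s≤s (hue≤1 hub∈)) (ℕ.m≤m+n 2 _))
    where
    hue≤1 : _∈ₑ_ mC₆ (c , i) (k , j) → hue (to position j) ≤ 1
    hue≤1 (inj₁ eq) = ℕ.≤-reflexive (cong hue
      (trans (cong (to position) (sym (cong proj₂ eq))) (unwind-self i)))
    hue≤1 (inj₂ eq) = ℕ.≤-trans (ℕ.≤-reflexive (hue-5 (to position j)
      (trans (sym (unwind-next (toℕ i) j)) (trans (cong (to position) (sym (cong proj₂ eq))) (unwind-self i))))) z≤n

  ends-distinct : ∀ e → vertexWeight G f (proj₁ (ends G e)) ≢ vertexWeight G f (proj₂ (ends G e))
  ends-distinct (inj₁ (k , j)) with _≟ᵛ_ mC₆ (k , j) (c , i) | _≟ᵛ_ mC₆ (k , next j) (c , i)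
  ... | yes p | yes q = contradiction (trans p (sym q)) (loopless mC₆ (k , j))
  ... | yes refl | no q = subst (vertexWeight G f hub ≢_) (sym (vertexWeight-cycle k (next j) q)) (hub≢cycleWeight (next (next j)))
  ... | no p | yes q = subst₂ _≢_ (sym (vertexWeight-cycle k j p)) (cong (vertexWeight G f ∘ inj₁) (sym q)) (≢-sym (hub≢cycleWeight (next j)))
  ... | no p | no q = subst₂ _≢_ (sym (vertexWeight-cycle k j p)) (sym (vertexWeight-cycle k (next j) q)) (≢-sym (cycleWeight-next≢ (next j)))
  ends-distinct (inj₂ j) = subst (vertexWeight G f hub ≢_) (sym (vertexWeight-pendant j)) (hub≢pendantWeight (to τ j))

  -- A cycle vertex other than the hub has the weight of an edge one step after one of its two edges
  -- and two steps after the other. The hub outweighs everything, and pendant vertices are handled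
  -- by the derangement.
  incident-distinct : ∀ x e → _∈ₑ_ G x e → vertexWeight G f x ≢ edgeWeight G f e
  incident-distinct (inj₁ (k , j)) (inj₁ e@(k′ , j′)) x∈e
    with _≟ᵛ_ mC₆ (k , j) (c , i)
  ... | yes refl = subst (vertexWeight G f hub ≢_) (sym (edgeWeight-cycle k′ j′)) (hub≢cycleWeight j′)
  ... | no p = subst₂ _≢_ (sym (vertexWeight-cycle k j p)) (sym (edgeWeight-cycle k′ j′)) (apart x∈e)
    where
    apart : _∈ₑ_ G (inj₁ (k , j)) (inj₁ e) → cycleWeight (next j) ≢ cycleWeight j′
    apart (inj₁ refl) = cycleWeight-next≢ j
    apart (inj₂ refl) = cycleWeight-next²≢ j′
  incident-distinct x (inj₂ l) (inj₁ refl) =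
    subst (vertexWeight G f hub ≢_) (sym (edgeWeight-pendant l)) (hub≢pendantWeight l)
  incident-distinct x (inj₂ l) (inj₂ refl) =
    subst₂ _≢_ (sym (vertexWeight-pendant l)) (sym (edgeWeight-pendant l)) (τ-derangement l ∘ pendantWeight-injective (to τ l) l)
  incident-distinct (inj₂ _) (inj₁ _) (inj₁ ())
  incident-distinct (inj₂ _) (inj₁ _) (inj₂ ())

  cycle≢pendant : ∀ {x} k j l → _∈ₑ_ G x (inj₁ (k , j)) → _∈ₑ_ G x (inj₂ l) →
    edgeWeight G f (inj₁ (k , j)) ≢ edgeWeight G f (inj₂ l)
  cycle≢pendant k j l (inj₁ refl) (inj₁ eq) = subst₂ _≢_ (sym (edgeWeight-cycle k j)) (sym (edgeWeight-pendant l))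
    (ℕ.<⇒≢ (cycleWeight<pendantWeight (inj₁ (sym (inj₁-injective eq))) l))
  cycle≢pendant k j l (inj₂ refl) (inj₁ eq) = subst₂ _≢_ (sym (edgeWeight-cycle k j)) (sym (edgeWeight-pendant l))
    (ℕ.<⇒≢ (cycleWeight<pendantWeight (inj₂ (sym (inj₁-injective eq))) l))

  cycle≢cycle : ∀ {x e e′} → e ≢ e′ → _∈ₑ_ mC₆ x e → _∈ₑ_ mC₆ x e′ → cycleWeight (proj₂ e) ≢ cycleWeight (proj₂ e′)
  cycle≢cycle e≢e′ (inj₁ refl) (inj₁ refl) = contradiction refl e≢e′
  cycle≢cycle {e′ = _ , j′} e≢e′ (inj₁ refl) (inj₂ refl) = cycleWeight-next≢ j′
  cycle≢cycle {e = _ , j} e≢e′ (inj₂ refl) (inj₁ refl) = ≢-sym (cycleWeight-next≢ j)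
  -- A common second end forces the edges to be equal, because `next` is injective.
  cycle≢cycle {e = _ , j} {_ , j′} e≢e′ (inj₂ refl) (inj₂ eq) = contradiction
    (cong₂ _,_ (cong proj₁ eq)
      (trans (sym (prev-next j)) (trans (cong (prev ∘ proj₂) eq) (prev-next j′)))) e≢e′

  adjacentEdges-distinct : ∀ e e′ → AdjacentEdges G e e′ → edgeWeight G f e ≢ edgeWeight G f e′
  adjacentEdges-distinct (inj₁ (k , j)) (inj₁ (k′ , j′)) (e≢e′ , inj₁ x , x∈e , x∈e′) =
    subst₂ _≢_ (sym (edgeWeight-cycle k j)) (sym (edgeWeight-cycle k′ j′))
      (cycle≢cycle (e≢e′ ∘ cong inj₁) (∈ₑ-inj₁⁻ mC₆ (c , i) s x∈e) (∈ₑ-inj₁⁻ mC₆ (c , i) s x∈e′))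
  adjacentEdges-distinct (inj₁ _) (inj₁ _) (_ , inj₂ _ , inj₁ () , _)
  adjacentEdges-distinct (inj₁ _) (inj₁ _) (_ , inj₂ _ , inj₂ () , _)
  adjacentEdges-distinct (inj₁ (k , j)) (inj₂ l) (_ , _ , x∈e , x∈e′) = cycle≢pendant k j l x∈e x∈e′
  adjacentEdges-distinct (inj₂ l) (inj₁ (k , j)) (_ , _ , x∈e , x∈e′) = ≢-sym (cycle≢pendant k j l x∈e′ x∈e)
  adjacentEdges-distinct (inj₂ j) (inj₂ l) (e≢e′ , _) =
    subst₂ _≢_ (sym (edgeWeight-pendant j)) (sym (edgeWeight-pendant l)) (e≢e′ ∘ cong inj₂ ∘ pendantWeight-injective j l)

  antimagic : IsLocalTotalAntimagic G f
  antimagic = record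
    { vertices-distinct  = λ where
        _ _ (e , inj₁ (refl , refl)) → ends-distinct e
        _ _ (e , inj₂ (refl , refl)) → ≢-sym (ends-distinct e)
    ; edges-distinct     = adjacentEdges-distinct
    ; incidence-distinct = incident-distinct
    }

  -- Counting the weights.

  -- N + 2 is not listed separately: it is already the least pendant weight, which keeps the length
  -- at s + 3.
  weightValues : List ℕ
  weightValues = N + 0 ∷ N + 1 ∷ vertexWeight G f hub ∷ map pendantWeight (allFin s)

  pendantWeight∈ : ∀ j → pendantWeight j ∈ weightValues
  pendantWeight∈ j = there (there (there (∈-map⁺ pendantWeight (∈-allFin j))))

  cycleWeight∈ : ∀ j → cycleWeight j ∈ weightValues
  cycleWeight∈ j = hue∈ (to position j)
    where
    hue∈ : ∀ p → N + hue p ∈ weightValues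
    hue∈ 0F = there (here refl)
    hue∈ 1F = subst (_∈ weightValues) (proj₂ pendantWeight-least) (pendantWeight∈ (proj₁ pendantWeight-least))
    hue∈ 2F = here refl
    hue∈ 3F = there (here refl)
    hue∈ 4F = subst (_∈ weightValues) (proj₂ pendantWeight-least) (pendantWeight∈ (proj₁ pendantWeight-least))
    hue∈ 5F = here refl

  vertexWeight∈ : ∀ x → vertexWeight G f x ∈ weightValues
  vertexWeight∈ (inj₁ (k , j)) with _≟ᵛ_ mC₆ (k , j) (c , i)
  ... | yes refl = there (there (here refl))
  ... | no ≢hub  = subst (_∈ weightValues) (sym (vertexWeight-cycle k j ≢hub)) (cycleWeight∈ (next j))
  vertexWeight∈ (inj₂ j) = subst (_∈ weightValues) (sym (vertexWeight-pendant j)) (pendantWeight∈ (to τ j))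

  edgeWeight∈ : ∀ e → edgeWeight G f e ∈ weightValues
  edgeWeight∈ (inj₁ (k , j)) = subst (_∈ weightValues) (sym (edgeWeight-cycle k j)) (cycleWeight∈ j)
  edgeWeight∈ (inj₂ j)       = subst (_∈ weightValues) (sym (edgeWeight-pendant j)) (pendantWeight∈ j)

  numberOfWeights≤s+3 : numberOfWeights G f ≤ s + 3
  numberOfWeights≤s+3 = subst (numberOfWeights G f ≤_)
    (trans (cong (3 +_) (trans (length-map pendantWeight (allFin s)) (length-tabulate {n = s} id))) (ℕ.+-comm 3 s))
    (numberOfWeights-≤ G f weightValues vertexWeight∈ edgeWeight∈)

corollary4p1 : (m s : ℕ) → 1 ≤ m → 2 ≤ s →
    (v : Graph.Vertex (m copiesOf C₆)) →
    let G = attachPendants (m copiesOf C₆) v s in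
    (χlt[ G ]≡ (Δ G + 1)) × (Δ G + 1 ≡ s + 3)
corollary4p1 m s _ 2≤s v@(c , i) =
  subst (χlt[ G ]≡_) (sym Δ+1≡s+3)
    -- The lower bound, applied to the constructed labelling, turns its upper bound into an
    -- equality.
    ((f , antimagic , ℕ.≤-antisym numberOfWeights≤s+3 (s+3≤ f antimagic)) , s+3≤) ,
  Δ+1≡s+3
  where
  open Construction m s 2≤s c i using (G; hub; f; antimagic; numberOfWeights≤s+3)

  Δ+1≡s+3 : Δ G + 1 ≡ s + 3
  Δ+1≡s+3 = trans (cong (_+ 1) (Δ-pendants m s v)) (ℕ.+-assoc s 2 1)

  s+3≤ : ∀ f → IsLocalTotalAntimagic G f → s + 3 ≤ numberOfWeights G f
  s+3≤ f antimagic = subst (_≤ numberOfWeights G f)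
    (trans (cong suc (degree-mC₆-hub m s v)) (sym (ℕ.+-suc s 2)))
    (degree<numberOfWeights G f antimagic hub)
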